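{- Let $(N_1,m_1)$, $(N_2,m_2)$, $(N_3,m_3)$ be labeled marked Petri nets with place sets $P_1,P_2,P_3$ (labelings over a common alphabet $\Sigma$), and $E,E'$ systems of linear constraints such that $(N_1,m_1)\vartriangleright_E(N_2,m_2)$ and $(N_2,m_2)\vartriangleright_{E'}(N_3,m_3)$, and these two equivalence statements are compatible. Then $(N_1,m_1)\vartriangleright_{E\wedge E'}(N_3,m_3)$.
   Context: A Petri net $N=(P,T,\mathrm{Pre},\mathrm{Post})$ has a finite set of places $P$, a finite set of transitions $T$ disjoint from $P$, and flow functions $\mathrm{Pre},\mathrm{Post}:T\to(P\to\mathbb N)$. A marking is a map $m:P\to\mathbb N$. Transition $t$ is enabled at $m$ if $m(p)\ge\mathrm{Pre}(t,p)$ for all $p$; firing it yields $m'=m-\mathrm{Pre}(t)+\mathrm{Post}(t)$. A firing sequence $\varrho=t_1\cdots t_n$ leads from $m$ to $m'$ ($m\overset{\varrho}{\Rightarrow}m'$) if the transitions can be fired successively from $m$ reaching $m'$. A labeled net has a labeling $l:T\to\Sigma\cup\{\tau\}$ ($\tau\notin\Sigma$ silent), extended to sequences by $l(\epsilon)=\epsilon$, $\tau$ mapped to $\epsilon$, $l(\varrho t)=l(\varrho)l(t)$. Formulas are Boolean combinations of linear (in)equalities over integer variables; place names are used as variables. For a marking $m$ over $P$, $\underline m\triangleq\bigwedge_{p\in P}(p=m(p))$; $m\models\phi$ means $\phi\wedge\underline m$ is satisfiable over the integers. Markings $m_1$ over $P_1$, $m_2$ over $P_2$ are compatible if they agree on $P_1\cap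 P_2$; then $m_1\uplus m_2$ is the marking on $P_1\cup P_2$ agreeing with both; $m_1\uplus m_2\models E$ presupposes compatibility. $E$-abstraction: $(N_1,m_1)\sqsupseteq_E(N_2,m_2)$ iff (A1) $m_1\uplus m_2\models E$; and (A2) for every firing sequence $m_1\overset{\varrho_1}{\Rightarrow}m_1'$ in $N_1$ there is at least one marking $m_2'$ over $P_2$ with $m_1'\uplus m_2'\models E$, and for every marking $m_2'$ over $P_2$ with $m_1'\uplus m_2'\models E$ there is a firing sequence $\varrho_2$ of $N_2$ with $m_2\overset{\varrho_2}{\Rightarrow}m_2'$ and $l_1(\varrho_1)=l_2(\varrho_2)$. $(N_1,m_1)\vartriangleright_E(N_2,m_2)$ means both $(N_1,m_1)\sqsupseteq_E(N_2,m_2)$ and $(N_2,m_2)\sqsupseteq_E(N_1,m_1)$. The fresh variables of a statement $(N_1,m_1)\vartriangleright_E(N_2,m_2)$ are the variables occurring in $E$ but not in $P_1\cup P_2$. The statement $(N_2,m_2)\vartriangleright_{E'}(N_3,m_3)$ is compatible with $(N_1,m_1)\vartriangleright_E(N_2,m_2)$ when $P_1\cap P_3\subseteq P_2$ and the fresh variables of the two statements are disjoint.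
   Formalization: Variables that are place names take only non-negative values in solutions (other variables are integers), and compatibility also requires that a fresh variable of one statement is not a place of the other's nets; without these the claim fails. -}

module Defs where

open import Data.Fin using (Fin)
open import Data.Integer as ℤ using (ℤ; +_)
open import Data.List using (List; []; _∷_; _++_; foldr; mapMaybe; tabulate)
open import Data.List.Membership.Propositional using (_∈_)
open import Data.Maybe using (Maybe)
open import Data.Nat as ℕ using (ℕ)
open import Data.Product using (∃-syntax; Σ-syntax; _×_; _,_)
open import Data.Sum using (_⊎_; inj₁; inj₂)
open import Data.Unit using (⊤)
open import Function.Bundles using (_↣_; Injection)
open import Relation.Binary.PropositionalEquality using (_≡_; _≗_)
open import Relation.Nullary using (¬_)

infix  8 _≐_ _≦_
infixr 7 _∧_
infixr 6 _∨_

data Term (V : Set) : Set where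
  const : ℤ → Term V
  var   : V → Term V
  _⊕_   : Term V → Term V → Term V
  _⊛_   : ℤ → Term V → Term V

-- The strict and reversed comparisons are Boolean combinations of _≦_.
data Formula (V : Set) : Set where
  true    : Formula V
  _≐_ _≦_ : Term V → Term V → Formula V
  ¬′_     : Formula V → Formula V
  _∧_ _∨_ : Formula V → Formula V → Formula V

⟦_⟧ᵗ : ∀ {V} → Term V → (V → ℤ) → ℤ
⟦ const k ⟧ᵗ σ = k
⟦ var x ⟧ᵗ   σ = σ x
⟦ s ⊕ t ⟧ᵗ   σ = ⟦ s ⟧ᵗ σ ℤ.+ ⟦ t ⟧ᵗ σ
⟦ k ⊛ t ⟧ᵗ   σ = k ℤ.* ⟦ t ⟧ᵗ σ

⟦_⟧ : ∀ {V} → Formula V → (V → ℤ) → Set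
⟦ true ⟧  σ = ⊤
⟦ s ≐ t ⟧ σ = ⟦ s ⟧ᵗ σ ≡ ⟦ t ⟧ᵗ σ
⟦ s ≦ t ⟧ σ = ⟦ s ⟧ᵗ σ ℤ.≤ ⟦ t ⟧ᵗ σ
⟦ ¬′ φ ⟧  σ = ¬ ⟦ φ ⟧ σ
⟦ φ ∧ ψ ⟧ σ = ⟦ φ ⟧ σ × ⟦ ψ ⟧ σ
⟦ φ ∨ ψ ⟧ σ = ⟦ φ ⟧ σ ⊎ ⟦ ψ ⟧ σ

varsᵗ : ∀ {V} → Term V → List V
varsᵗ (const k) = []
varsᵗ (var x)   = x ∷ []
varsᵗ (s ⊕ t)   = varsᵗ s ++ varsᵗ t
varsᵗ (k ⊛ t)   = varsᵗ t

vars : ∀ {V} → Formula V → List V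
vars true    = []
vars (s ≐ t) = varsᵗ s ++ varsᵗ t
vars (s ≦ t) = varsᵗ s ++ varsᵗ t
vars (¬′ φ)  = vars φ
vars (φ ∧ ψ) = vars φ ++ vars ψ
vars (φ ∨ ψ) = vars φ ++ vars ψ

⋀ : ∀ {V} → List (Formula V) → Formula V
⋀ = foldr _∧_ true

-- Nets draw their places from a common type `Place` of names, so that the
-- place sets of different nets may overlap.  A finite set of places is an
-- injective enumeration of names.  Transitions have their own type, hence are
-- never places.  The label `nothing` is the silent label τ.
record LabelledNet (Place Label : Set) : Set where
  field
    #places      : ℕ
    #transitions : ℕ
    places       : Fin #places ↣ Place
    Pre Post     : Fin #transitions → Fin #places → ℕ
    label        : Fin #transitions → Maybe Label

  open Injection places public using () renaming (to to name)

  Marking : Set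
  Marking = Fin #places → ℕ

  Transition : Set
  Transition = Fin #transitions

  Enabled : Transition → Marking → Set
  Enabled t m = ∀ p → m p ℕ.≥ Pre t p

  fire : Transition → Marking → Marking
  fire t m p = (m p ℕ.∸ Pre t p) ℕ.+ Post t p

  data _⇒[_]_ : Marking → List Transition → Marking → Set where
    done : ∀ {m m′} → m ≗ m′ → m ⇒[ [] ] m′
    step : ∀ {m t ϱ m′} → Enabled t m → fire t m ⇒[ ϱ ] m′ → m ⇒[ t ∷ ϱ ] m′

  trace : List Transition → List Label
  trace = mapMaybe label

-- Formulas have two sorts of variables: place names, and other integer
-- variables, drawn from `Aux`.
module _ {Place Aux Label : Set} where

  private
    Net : Set
    Net = LabelledNet Place Label

    Var : Set
    Var = Place ⊎ Aux

  open LabelledNet using (Marking; name; #places; _⇒[_]_; trace)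

  MarkedNet : Set
  MarkedNet = Σ[ N ∈ Net ] Marking N

  _∈P_ : Var → Net → Set
  x ∈P N = ∃[ i ] x ≡ inj₁ (name N i)

  -- Valuations are integral, but a place name stands for a number of tokens and
  -- is non-negative.  This matters only for place names outside the two nets
  -- being compared, such as the places of an intermediate net.  Otherwise
  -- abstractions would not compose: for nets without transitions and with the
  -- single places p₁, p₂, p₃, all empty, take E = (p₁ = 0 ∧ p₂ ≤ 0) and
  -- E′ = (p₂ + p₃ = 0).  Over ℤ, E ∧ E′ leaves p₃ ≥ 0 arbitrary when p₁ = 0.
  Satisfiable : Formula Var → Set
  Satisfiable φ = ∃[ σ ] (∀ (p : Place) → + 0 ℤ.≤ σ (inj₁ p)) × ⟦ φ ⟧ σ

  underline : MarkedNet → Formula Var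
  underline (N , m) = ⋀ (tabulate λ i → var (inj₁ (name N i)) ≐ const (+ m i))

  Agree : MarkedNet → MarkedNet → Set
  Agree (N₁ , m₁) (N₂ , m₂) = ∀ i j → name N₁ i ≡ name N₂ j → m₁ i ≡ m₂ j

  -- For compatible markings, the formula describing m₁ ⊎ m₂ is the conjunction
  -- of those describing m₁ and m₂, up to repetition of the shared places.
  infix 4 _⊎_⊨_
  _⊎_⊨_ : MarkedNet → MarkedNet → Formula Var → Set
  M₁ ⊎ M₂ ⊨ φ = Agree M₁ M₂ × Satisfiable (φ ∧ (underline M₁ ∧ underline M₂))

  infix 4 _⊒[_]_ _▷[_]_
  _⊒[_]_ : MarkedNet → Formula Var → MarkedNet → Set
  (N₁ , m₁) ⊒[ E ] (N₂ , m₂) =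
    ((N₁ , m₁) ⊎ (N₂ , m₂) ⊨ E) ×
    (∀ ϱ₁ m₁′ → _⇒[_]_ N₁ m₁ ϱ₁ m₁′ →
      (Σ[ m₂′ ∈ Marking N₂ ] ((N₁ , m₁′) ⊎ (N₂ , m₂′) ⊨ E)) ×
      (∀ (m₂′ : Marking N₂) → (N₁ , m₁′) ⊎ (N₂ , m₂′) ⊨ E →
        ∃[ ϱ₂ ] _⇒[_]_ N₂ m₂ ϱ₂ m₂′ × trace N₁ ϱ₁ ≡ trace N₂ ϱ₂))

  _▷[_]_ : MarkedNet → Formula Var → MarkedNet → Set
  M₁ ▷[ E ] M₂ = (M₁ ⊒[ E ] M₂) × (M₂ ⊒[ E ] M₁)

  Fresh : Net → Formula Var → Net → Var → Set
  Fresh N₁ E N₂ x = x ∈ vars E × ¬ (x ∈P N₁) × ¬ (x ∈P N₂)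

  -- Compatibility of the statements (N₁,_) ▷[ E ] (N₂,_) and
  -- (N₂,_) ▷[ E′ ] (N₃,_).  A variable fresh in one of them is new to the other:
  -- it is neither fresh there nor one of its places.  Without the last two
  -- fields, E could constrain a place of N₃ by using its name as a fresh
  -- variable, and E ∧ E′ could be unsatisfiable.
  record Compatible (N₁ : Net) (E : Formula Var) (N₂ : Net)
                    (E′ : Formula Var) (N₃ : Net) : Set where
    field
      shared         : ∀ x → x ∈P N₁ → x ∈P N₃ → x ∈P N₂
      fresh-disjoint : ∀ x → Fresh N₁ E N₂ x → ¬ Fresh N₂ E′ N₃ x
      fresh-∉N₃      : ∀ x → Fresh N₁ E N₂ x → ¬ (x ∈P N₃)
      fresh-∉N₁      : ∀ x → Fresh N₂ E′ N₃ x → ¬ (x ∈P N₁)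

{-# OPTIONS --safe #-}
-- Satisfying valuations of E and E′ for markings that agree on N₂ can be glued:
-- take the first one on P₁ ∪ P₂ ∪ vars E and the second one elsewhere, since
-- compatibility confines the variables common to both statements to P₂.
-- Conversely, a valuation satisfying E ∧ E′ is non-negative on place names, so
-- that its restriction to P₂ is an intermediate marking.  Hence the relation
-- defined by E ∧ E′ is the composite of those defined by E and E′, and firing
-- sequences are transferred through N₂.
module Submission where

open import Defs
open import Data.Fin using (Fin; zero; suc)
open import Data.Fin.Properties using (any?)
open import Data.Integer as ℤ using (ℤ; +_; ∣_∣)
open import Data.Integer.Properties using (+-injective; 0≤i⇒+∣i∣≡i)
open import Data.List using (tabulate)
open import Data.List.Membership.Propositional using (_∈_)
open import Data.List.Membership.Propositional.Properties using (∈-++⁺ˡ; ∈-++⁺ʳ)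
import Data.List.Membership.DecPropositional as DecMembership
open import Data.List.Relation.Unary.Any using (here)
open import Data.Nat using (zero; suc)
open import Data.Product using (Σ-syntax; _×_; _,_; proj₂; swap)
open import Data.Sum as Sum using (_⊎_; inj₁; inj₂)
open import Data.Sum.Properties using (≡-dec)
open import Data.Unit using (tt)
open import Function using (_∘_; case_of_)
open import Relation.Binary.Definitions using (DecidableEquality)
open import Relation.Binary.PropositionalEquality
  using (_≡_; refl; sym; trans; cong; cong₂; subst₂)
open import Relation.Nullary using (Dec; yes; no; contradiction; _⊎-dec_)
open import Relation.Unary using (Decidable)

_≈[_]_ : {V : Set} → (V → ℤ) → (V → Set) → (V → ℤ) → Set
σ ≈[ X ] τ = ∀ x → X x → σ x ≡ τ x

⟦⟧ᵗ-cong : ∀ {V} (t : Term V) {σ τ} → σ ≈[ _∈ varsᵗ t ] τ → ⟦ t ⟧ᵗ σ ≡ ⟦ t ⟧ᵗ τ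
⟦⟧ᵗ-cong (const k) eq = refl
⟦⟧ᵗ-cong (var x)   eq = eq x (here refl)
⟦⟧ᵗ-cong (s ⊕ t)   eq = cong₂ ℤ._+_
  (⟦⟧ᵗ-cong s λ x → eq x ∘ ∈-++⁺ˡ)
  (⟦⟧ᵗ-cong t λ x → eq x ∘ ∈-++⁺ʳ (varsᵗ s))
⟦⟧ᵗ-cong (k ⊛ t)   eq = cong (k ℤ.*_) (⟦⟧ᵗ-cong t eq)

-- This is what lets a valuation be altered off `vars φ`, as gluing does.
⟦⟧-resp : ∀ {V} (φ : Formula V) {σ τ} → σ ≈[ _∈ vars φ ] τ → ⟦ φ ⟧ σ → ⟦ φ ⟧ τ
⟦⟧-resp true    eq h = tt
⟦⟧-resp (s ≐ t) eq h = subst₂ _≡_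
  (⟦⟧ᵗ-cong s λ x → eq x ∘ ∈-++⁺ˡ)
  (⟦⟧ᵗ-cong t λ x → eq x ∘ ∈-++⁺ʳ (varsᵗ s)) h
⟦⟧-resp (s ≦ t) eq h = subst₂ ℤ._≤_
  (⟦⟧ᵗ-cong s λ x → eq x ∘ ∈-++⁺ˡ)
  (⟦⟧ᵗ-cong t λ x → eq x ∘ ∈-++⁺ʳ (varsᵗ s)) h
-- Negation is contravariant: the induction hypothesis carries truth from `τ` back to `σ`, so the
-- equalities are reversed.
⟦⟧-resp (¬′ φ)  eq h = h ∘ ⟦⟧-resp φ (λ x → sym ∘ eq x)
⟦⟧-resp (φ ∧ ψ) eq (h , k) =
  ⟦⟧-resp φ (λ x → eq x ∘ ∈-++⁺ˡ) h ,
  ⟦⟧-resp ψ (λ x → eq x ∘ ∈-++⁺ʳ (vars φ)) k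
⟦⟧-resp (φ ∨ ψ) eq = Sum.map
  (⟦⟧-resp φ λ x → eq x ∘ ∈-++⁺ˡ)
  (⟦⟧-resp ψ λ x → eq x ∘ ∈-++⁺ʳ (vars φ))

⋀-tabulate⁺ : ∀ {V} n (φ : Fin n → Formula V) {σ} →
              (∀ i → ⟦ φ i ⟧ σ) → ⟦ ⋀ (tabulate φ) ⟧ σ
⋀-tabulate⁺ zero    φ h = tt
⋀-tabulate⁺ (suc n) φ h = h zero , ⋀-tabulate⁺ n (φ ∘ suc) (h ∘ suc)

⋀-tabulate⁻ : ∀ {V} n (φ : Fin n → Formula V) {σ} →
              ⟦ ⋀ (tabulate φ) ⟧ σ → ∀ i → ⟦ φ i ⟧ σ
⋀-tabulate⁻ (suc n) φ (h , _)  zero    = h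
⋀-tabulate⁻ (suc n) φ (_ , hs) (suc i) = ⋀-tabulate⁻ n (φ ∘ suc) hs i

piecewise : {V : Set} {X : V → Set} → Decidable X → (V → ℤ) → (V → ℤ) → V → ℤ
piecewise X? σ τ x = case X? x of λ where
  (yes _) → σ x
  (no  _) → τ x

module _ {V : Set} {X : V → Set} (X? : Decidable X) (σ τ : V → ℤ) where

  piecewise-inside : σ ≈[ X ] piecewise X? σ τ
  piecewise-inside x x∈X with X? x
  ... | yes _   = refl
  ... | no  x∉X = contradiction x∈X x∉X

  -- The variables of `E′` and the places of `N₃` may meet `X`, so being outside `X` is too strong a
  -- condition; agreement of `σ` and `τ` on the overlap is enough.
  piecewise-agree : ∀ x → (X x → σ x ≡ τ x) → τ x ≡ piecewise X? σ τ x
  piecewise-agree x eq with X? x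
  ... | yes x∈X = sym (eq x∈X)
  ... | no  _   = refl

  piecewise-preserves : (P : ℤ → Set) → ∀ x → P (σ x) → P (τ x) → P (piecewise X? σ τ x)
  piecewise-preserves P x pσ pτ with X? x
  ... | yes _ = pσ
  ... | no  _ = pτ

module _ {Place Aux Label : Set} where

  open LabelledNet using (Marking; name; #places)

  private
    Net : Set
    Net = LabelledNet Place Label

    Var : Set
    Var = Place ⊎ Aux

    Marked : Set
    Marked = MarkedNet {Place} {Aux} {Label}

    variable
      E F E′   : Formula Var
      N₁ N₂ N₃ : Net

  underline⁺ : (N : Net) (m : Marking N) {σ : Var → ℤ} →
               (∀ i → σ (inj₁ (name N i)) ≡ + m i) → ⟦ underline (N , m) ⟧ σ
  underline⁺ N m = ⋀-tabulate⁺ (#places N) _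

  underline⁻ : (N : Net) (m : Marking N) {σ : Var → ℤ} →
               ⟦ underline (N , m) ⟧ σ → ∀ i → σ (inj₁ (name N i)) ≡ + m i
  underline⁻ N m = ⋀-tabulate⁻ (#places N) _

  -- A shared name has a single value under `σ`, and `+_` is injective.
  valuation⇒Agree : (N₁ N₂ : Net) {m₁ : Marking N₁} {m₂ : Marking N₂} (σ : Var → ℤ) →
                    (∀ i → σ (inj₁ (name N₁ i)) ≡ + m₁ i) →
                    (∀ j → σ (inj₁ (name N₂ j)) ≡ + m₂ j) →
                    Agree {Aux = Aux} (N₁ , m₁) (N₂ , m₂)
  valuation⇒Agree N₁ N₂ σ σ≡m₁ σ≡m₂ i j i≡j =
    +-injective (trans (sym (σ≡m₁ i)) (trans (cong (σ ∘ inj₁) i≡j) (σ≡m₂ j)))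

  ⊨-map : (M₁ M₂ : Marked) → (∀ σ → ⟦ E ⟧ σ → ⟦ F ⟧ σ) → M₁ ⊎ M₂ ⊨ E → M₁ ⊎ M₂ ⊨ F
  ⊨-map _ _ E⇒F (agree , σ , σ≥0 , e , u) = agree , σ , σ≥0 , E⇒F σ e , u

  -- `E` occurs positively in the initial condition and in the existence of `m₂′`, but negatively
  -- where `m₂′` is universally quantified; hence implications both ways.
  ⊒-resp : {M₁ M₂ : Marked} → (∀ σ → ⟦ E ⟧ σ → ⟦ F ⟧ σ) → (∀ σ → ⟦ F ⟧ σ → ⟦ E ⟧ σ) →
           M₁ ⊒[ E ] M₂ → M₁ ⊒[ F ] M₂
  ⊒-resp {E} {F} {M₁ = N₁ , m₁} {N₂ , m₂} E⇒F F⇒E (init , sim) =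
    ⊨-map {E} {F} (N₁ , m₁) (N₂ , m₂) E⇒F init , λ ϱ₁ m₁′ run →
      let (m₂′ , sat) , reach = sim ϱ₁ m₁′ run
      in (m₂′ , ⊨-map {E} {F} (N₁ , m₁′) (N₂ , m₂′) E⇒F sat) ,
         λ m₂″ sat′ → reach m₂″ (⊨-map {F} {E} (N₁ , m₁′) (N₂ , m₂″) F⇒E sat′)

  -- Reading the chain from `N₃` to `N₁` lets one proof of transitivity serve both directions of the
  -- equivalence.
  Compatible-sym : Compatible N₁ E N₂ E′ N₃ → Compatible N₃ E′ N₂ E N₁
  Compatible-sym compat = record
    { shared         = λ x x∈N₃ x∈N₁ → shared x x∈N₁ x∈N₃
    ; fresh-disjoint = λ x f′ f → fresh-disjoint x (flip f) (flip f′)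
    ; fresh-∉N₃      = λ x → fresh-∉N₁ x ∘ flip
    ; fresh-∉N₁      = λ x → fresh-∉N₃ x ∘ flip
    }
    where
      open Compatible compat
      flip : ∀ {A B C : Set} → A × B × C → A × C × B
      flip (a , b , c) = a , c , b

  ⊨-split : (N₁ N₂ N₃ : Net) (m₁ : Marking N₁) (m₃ : Marking N₃) →
            (N₁ , m₁) ⊎ (N₃ , m₃) ⊨ E ∧ E′ →
            Σ[ m₂ ∈ Marking N₂ ] ((N₁ , m₁) ⊎ (N₂ , m₂) ⊨ E) × ((N₂ , m₂) ⊎ (N₃ , m₃) ⊨ E′)
  ⊨-split N₁ N₂ N₃ m₁ m₃ (_ , σ , σ≥0 , (e , e′) , u₁ , u₃) =
    m₂ ,
    (valuation⇒Agree N₁ N₂ σ (underline⁻ N₁ m₁ u₁) σ≡m₂ , σ , σ≥0 , e , u₁ , u₂) ,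
    (valuation⇒Agree N₂ N₃ σ σ≡m₂ (underline⁻ N₃ m₃ u₃) , σ , σ≥0 , e′ , u₂ , u₃)
    where
      m₂ : Marking N₂
      -- The absolute value only converts ℤ to ℕ; it changes nothing, by `σ≥0`.
      m₂ i = ∣ σ (inj₁ (name N₂ i)) ∣

      σ≡m₂ : ∀ i → σ (inj₁ (name N₂ i)) ≡ + m₂ i
      σ≡m₂ i = sym (0≤i⇒+∣i∣≡i (σ≥0 (name N₂ i)))

      u₂ : ⟦ underline (N₂ , m₂) ⟧ σ
      u₂ = underline⁺ N₂ m₂ σ≡m₂

  module _ (_≟P_ : DecidableEquality Place) (_≟A_ : DecidableEquality Aux) where

    _≟_ : DecidableEquality Var
    _≟_ = ≡-dec _≟P_ _≟A_

    _∈P?_ : (x : Var) (N : Net) → Dec (x ∈P N)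
    x ∈P? N = any? λ i → x ≟ inj₁ (name N i)

    open DecMembership _≟_ using (_∈?_)

    ⊨-glue : (N₁ N₂ N₃ : Net) (m₁ : Marking N₁) (m₂ : Marking N₂) (m₃ : Marking N₃) →
             Compatible N₁ E N₂ E′ N₃ →
             (N₁ , m₁) ⊎ (N₂ , m₂) ⊨ E → (N₂ , m₂) ⊎ (N₃ , m₃) ⊨ E′ →
             (N₁ , m₁) ⊎ (N₃ , m₃) ⊨ E ∧ E′
    ⊨-glue {E} {E′} N₁ N₂ N₃ m₁ m₂ m₃ compat
      (_ , σ , σ≥0 , e , u₁ , u₂) (_ , σ′ , σ′≥0 , e′ , u₂′ , u₃) =
      valuation⇒Agree N₁ N₃ τ τ≡m₁ τ≡m₃ ,
      τ ,
      (λ p → piecewise-preserves Dom? σ σ′ (+ 0 ℤ.≤_) (inj₁ p) (σ≥0 p) (σ′≥0 p)) ,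
      (⟦⟧-resp E (λ x → piecewise-inside Dom? σ σ′ x ∘ inj₂ ∘ inj₂) e ,
       ⟦⟧-resp E′ (λ x → piecewise-agree Dom? σ σ′ x ∘ σ≡σ′-on-common x ∘ inj₂) e′) ,
      underline⁺ N₁ m₁ τ≡m₁ ,
      underline⁺ N₃ m₃ τ≡m₃
      where
        open Compatible compat

        Dom : Var → Set
        Dom x = x ∈P N₁ ⊎ x ∈P N₂ ⊎ x ∈ vars E

        Dom? : Decidable Dom
        Dom? x = (x ∈P? N₁) ⊎-dec (x ∈P? N₂) ⊎-dec (x ∈? vars E)

        τ : Var → ℤ
        τ = piecewise Dom? σ σ′

        -- Both valuations satisfy the description of the same marking `m₂`.
        σ≡σ′-on-N₂ : σ ≈[ _∈P N₂ ] σ′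
        σ≡σ′-on-N₂ _ (i , refl) =
          trans (underline⁻ N₂ m₂ u₂ i) (sym (underline⁻ N₂ m₂ u₂′ i))

        -- Outside `N₂`, a common variable would be a place of both `N₁` and `N₃`, a fresh variable
        -- of one statement naming a place of the other outer net, or fresh in both. Each field of
        -- `Compatible` settles one of these cases.
        common∈N₂ : ∀ x → x ∈P N₃ ⊎ x ∈ vars E′ → Dom x → x ∈P N₂
        common∈N₂ x right left with x ∈P? N₂ | x ∈P? N₁ | x ∈P? N₃
        ... | yes x∈N₂ | _        | _        = x∈N₂
        ... | no  x∉N₂ | yes x∈N₁ | yes x∈N₃ = shared x x∈N₁ x∈N₃
        common∈N₂ x (inj₁ x∈N₃) _ | no x∉N₂ | _ | no x∉N₃ = contradiction x∈N₃ x∉N₃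
        common∈N₂ x (inj₂ x∈E′) _ | no x∉N₂ | yes x∈N₁ | no x∉N₃ =
          contradiction x∈N₁ (fresh-∉N₁ x (x∈E′ , x∉N₂ , x∉N₃))
        common∈N₂ x _ (inj₁ x∈N₁)        | no x∉N₂ | no x∉N₁ | _ = contradiction x∈N₁ x∉N₁
        common∈N₂ x _ (inj₂ (inj₁ x∈N₂)) | no x∉N₂ | no x∉N₁ | _ = x∈N₂
        common∈N₂ x _ (inj₂ (inj₂ x∈E))  | no x∉N₂ | no x∉N₁ | yes x∈N₃ =
          contradiction x∈N₃ (fresh-∉N₃ x (x∈E , x∉N₁ , x∉N₂))
        common∈N₂ x (inj₂ x∈E′) (inj₂ (inj₂ x∈E)) | no x∉N₂ | no x∉N₁ | no x∉N₃ =
          contradiction (x∈E′ , x∉N₂ , x∉N₃) (fresh-disjoint x (x∈E , x∉N₁ , x∉N₂))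

        σ≡σ′-on-common : ∀ x → x ∈P N₃ ⊎ x ∈ vars E′ → Dom x → σ x ≡ σ′ x
        σ≡σ′-on-common x right = σ≡σ′-on-N₂ x ∘ common∈N₂ x right

        τ≡m₁ : ∀ i → τ (inj₁ (name N₁ i)) ≡ + m₁ i
        τ≡m₁ i = trans
          (sym (piecewise-inside Dom? σ σ′ _ (inj₁ (i , refl))))
          (underline⁻ N₁ m₁ u₁ i)

        τ≡m₃ : ∀ i → τ (inj₁ (name N₃ i)) ≡ + m₃ i
        τ≡m₃ i = trans
          (sym (piecewise-agree Dom? σ σ′ _ (σ≡σ′-on-common _ (inj₁ (i , refl)))))
          (underline⁻ N₃ m₃ u₃ i)

    ⊒-trans : (N₁ N₂ N₃ : Net) (m₁ : Marking N₁) (m₂ : Marking N₂) (m₃ : Marking N₃) →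
              Compatible N₁ E N₂ E′ N₃ →
              (N₁ , m₁) ⊒[ E ] (N₂ , m₂) → (N₂ , m₂) ⊒[ E′ ] (N₃ , m₃) →
              (N₁ , m₁) ⊒[ E ∧ E′ ] (N₃ , m₃)
    ⊒-trans N₁ N₂ N₃ m₁ m₂ m₃ compat (init , sim) (init′ , sim′) =
      ⊨-glue N₁ N₂ N₃ m₁ m₂ m₃ compat init init′ , λ ϱ₁ m₁′ run₁ →
        -- `m₂′` must be reachable in `N₂` before `sim′` can supply a matching `m₃′`.
        let (m₂′ , sat) , reach  = sim ϱ₁ m₁′ run₁
            ϱ₂ , run₂ , _        = reach m₂′ sat
            (m₃′ , sat′) , _     = sim′ ϱ₂ m₂′ run₂
        in (m₃′ , ⊨-glue N₁ N₂ N₃ m₁′ m₂′ m₃′ compat sat sat′) , λ m₃″ sat″ →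
          -- `m₂′` need not be related to the given `m₃″`, so an intermediate marking is read off
          -- from the valuation in `sat″`, and `N₂` is run anew to reach it.
          let m₂″ , satˡ , satʳ     = ⊨-split N₁ N₂ N₃ m₁′ m₃″ sat″
              ϱ₂″ , run₂″ , trace₁₂ = reach m₂″ satˡ
              ϱ₃ , run₃ , trace₂₃   = proj₂ (sim′ ϱ₂″ m₂″ run₂″) m₃″ satʳ
          in ϱ₃ , run₃ , trans trace₁₂ trace₂₃

theorem1 : {Place Aux Label : Set} →
    DecidableEquality Place → DecidableEquality Aux →
    (N₁ N₂ N₃ : LabelledNet Place Label)
    (m₁ : LabelledNet.Marking N₁) (m₂ : LabelledNet.Marking N₂) (m₃ : LabelledNet.Marking N₃)
    (E E′ : Formula (Place ⊎ Aux)) →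
    (N₁ , m₁) ▷[ E ] (N₂ , m₂) →
    (N₂ , m₂) ▷[ E′ ] (N₃ , m₃) →
    Compatible N₁ E N₂ E′ N₃ →
    (N₁ , m₁) ▷[ E ∧ E′ ] (N₃ , m₃)
theorem1 _≟P_ _≟A_ N₁ N₂ N₃ m₁ m₂ m₃ E E′ (12⊒ , 21⊒) (23⊒ , 32⊒) compat =
  ⊒-trans _≟P_ _≟A_ N₁ N₂ N₃ m₁ m₂ m₃ compat 12⊒ 23⊒ ,
  -- The reversed chain produces the conjuncts in the opposite order.
  ⊒-resp {E = E′ ∧ E} {F = E ∧ E′} (λ _ → swap) (λ _ → swap)
    (⊒-trans _≟P_ _≟A_ N₃ N₂ N₁ m₃ m₂ m₁ (Compatible-sym compat) 32⊒ 21⊒)
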